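{- Let $i\in[n]$. For every $B\subseteq[n]\setminus\{i\}$ and every input $x_1,\dots,x_n\in\mathbb{R}$, the sign of $\Pi_{i,B}$ equals the sign of $P(i,B^{\neq})$, and this sign is determined by at most $\lceil\log_2(|B|+1)\rceil+1$ polynomial tests of degree at most $2|B|$.
   Context: $[n]=\{1,\dots,n\}$. Inputs are arbitrary reals $x_1,\dots,x_n$, not necessarily pairwise distinct. For $i\in[n]$ and $D\subseteq[n]\setminus\{i\}$ put $P(i,D)=\prod_{a\in D}(x_i-x_a)$ (the empty product being $1$). For $B\subseteq[n]\setminus\{i\}$ write $b=|B|$, $\mu_B=|\{a\in B: x_a=x_i\}|$, $B^{\neq}=\{a\in B: x_a\neq x_i\}$, and $$\Pi_{i,B}=\sum_{D\subseteq B,\ |D|=b-\mu_B}\ \prod_{a\in D}(x_i-x_a).$$ The sign of a real number is one of $<0$, $=0$, $>0$. A polynomial test is a ternary comparison $p(x_1,\dots,x_n):0$ with $p\in\mathbb{R}[x_1,\dots,x_n]$, revealing whether $p(x_1,\dots,x_n)$ is $<0$, $=0$ or $>0$; its degree is the degree of $p$. Tests are performed adaptively: the choice of each polynomial may depend on $i$, $B$ and the outcomes of the previous tests, but not otherwise on the input (in particular $\mu_B$ is not known in advance). "Determined by at most $k$ tests" means that there is a deterministic decision tree of depth at most $k$ using such tests whose output is the required sign on every input. -}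

module Defs where

open import Algebra.Bundles using (CommutativeRing; Semiring)
import Algebra.Definitions.RawSemiring as RawSemiringDefs
open import Data.Bool.Base using (if_then_else_)
open import Data.Fin.Base using (Fin)
open import Data.Fin.Subset using (Subset; inside; outside; ∣_∣; _∩_; ∁)
open import Data.Fin.Subset.Properties using (_⊆?_)
open import Data.List.Base as List using (List; []; _∷_; _++_; filter; foldr)
open import Data.List.Extrema.Nat using (max)
open import Data.Nat.Base as ℕ using (ℕ; zero; suc)
import Data.Nat.Properties as ℕ
open import Data.Product.Base using (Σ; ∃; _×_; _,_; proj₁; proj₂)
open import Data.Unit.Base using (⊤)
open import Data.Vec.Base as Vec using (Vec; []; _∷_; lookup; tabulate)
open import Data.Vec.Functional using (Vector)
open import Data.Vec.Properties using (≡-dec)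
open import Level using (_⊔_)
open import Relation.Binary.Core using (Rel)
open import Relation.Binary.Definitions using (tri<; tri≈; tri>)
import Relation.Binary.Construct.StrictToNonStrict as StrictToNonStrict
open import Relation.Binary.PropositionalEquality.Core using (_≡_)
open import Relation.Binary.Structures using (IsStrictTotalOrder)
open import Relation.Nullary using (¬_; does; ¬?; _×-dec_)

-- The (classical) real numbers, given by the axioms that determine them up to
-- isomorphism.  Trichotomy of the order is a field of IsStrictTotalOrder.
record CompleteOrderedField c ℓ₁ ℓ₂ : Set (Level.suc (c ⊔ ℓ₁ ⊔ ℓ₂)) where
  infix 4 _<_
  field
    commutativeRing : CommutativeRing c ℓ₁

  open CommutativeRing commutativeRing public

  field
    _<_                : Rel Carrier ℓ₂
    isStrictTotalOrder : IsStrictTotalOrder _≈_ _<_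
    0<1                : 0# < 1#
    +-monoʳ-<          : ∀ x {y z} → y < z → x + y < x + z
    *-pos              : ∀ {x y} → 0# < x → 0# < y → 0# < x * y
    inverse            : ∀ {x} → ¬ x ≈ 0# → ∃ λ y → x * y ≈ 1#

  open IsStrictTotalOrder isStrictTotalOrder public using (compare; _≟_)
  open StrictToNonStrict _≈_ _<_ public using (_≤_)

  UpperBound : (Carrier → Set (c ⊔ ℓ₁ ⊔ ℓ₂)) → Carrier → Set (c ⊔ ℓ₁ ⊔ ℓ₂)
  UpperBound S u = ∀ {x} → S x → x ≤ u

  field
    supremum : (S : Carrier → Set (c ⊔ ℓ₁ ⊔ ℓ₂)) → ∃ S → ∃ (UpperBound S) →
               ∃ λ s → UpperBound S s × (∀ {u} → UpperBound S u → s ≤ u)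

data Sign : Set where
  neg nil pos : Sign

subsets : ∀ n → List (Subset n)
subsets zero    = [] ∷ []
subsets (suc n) = List.map (outside ∷_) (subsets n) ++ List.map (inside ∷_) (subsets n)

module PolynomialTests {c ℓ₁ ℓ₂} (ℝ : CompleteOrderedField c ℓ₁ ℓ₂) where
  open CompleteOrderedField ℝ
  open RawSemiringDefs (Semiring.rawSemiring semiring) using (product; _^_)

  sign : Carrier → Sign
  sign r with compare r 0#
  ... | tri< _ _ _ = neg
  ... | tri≈ _ _ _ = nil
  ... | tri> _ _ _ = pos

  listSum : List Carrier → Carrier
  listSum = foldr _+_ 0#

  ∏∈ : ∀ {n} → Subset n → (Fin n → Carrier) → Carrier
  ∏∈ D f = product λ a → if lookup D a then f a else 1#

  module _ {n} (x : Vector Carrier n) (i : Fin n) where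

    P : Subset n → Carrier
    P D = ∏∈ D λ a → x i - x a

    ties : Subset n
    ties = tabulate λ a → does (x a ≟ x i)

    μ : Subset n → ℕ
    μ B = ∣ B ∩ ties ∣

    unequal : Subset n → Subset n
    unequal B = B ∩ ∁ ties

    Π : Subset n → Carrier
    Π B = listSum (List.map P
      (filter (λ D → (D ⊆? B) ×-dec (∣ D ∣ ℕ.≟ ∣ B ∣ ℕ.∸ μ B)) (subsets n)))

  Exponent : ℕ → Set
  Exponent n = Vec ℕ n

  -- A formal sum of terms (coefficient , exponent).  Exponents may repeat and
  -- coefficients may vanish or cancel, so degree looks at collected coefficients.
  Polynomial : ℕ → Set c
  Polynomial n = List (Carrier × Exponent n)

  eval : ∀ {n} → Polynomial n → Vector Carrier n → Carrier
  eval p x = listSum (List.map (λ (r , α) → r * product λ j → x j ^ lookup α j) p)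

  coefficient : ∀ {n} → Polynomial n → Exponent n → Carrier
  coefficient p α = listSum (List.map proj₁ (filter (λ t → ≡-dec ℕ._≟_ (proj₂ t) α) p))

  -- The zero polynomial gets degree 0.
  degree : ∀ {n} → Polynomial n → ℕ
  degree p = max 0 (List.map Vec.sum
    (filter (λ α → ¬? (coefficient p α ≟ 0#)) (List.map proj₂ p)))

  data DecisionTree (n : ℕ) (A : Set) : Set c where
    output : A → DecisionTree n A
    test   : Polynomial n → (Sign → DecisionTree n A) → DecisionTree n A

  run : ∀ {n A} → DecisionTree n A → Vector Carrier n → A
  run (output o) x = o
  run (test p k) x = run (k (sign (eval p x))) x

  depth : ∀ {n A} → DecisionTree n A → ℕ
  depth (output _) = 0
  depth (test _ k) = suc (depth (k neg) ℕ.⊔ depth (k nil) ℕ.⊔ depth (k pos))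

  TestDegrees≤ : ∀ {n A} → ℕ → DecisionTree n A → Set
  TestDegrees≤ d (output _) = ⊤
  TestDegrees≤ d (test p k) = degree p ℕ.≤ d × (∀ s → TestDegrees≤ d (k s))

  DeterminedByTests : ∀ {n} {A : Set} → ℕ → ℕ → (Vector Carrier n → A) → Set c
  DeterminedByTests {n} {A} k d f =
    Σ (DecisionTree n A) λ T → depth T ℕ.≤ k × TestDegrees≤ d T × (∀ x → run T x ≡ f x)

{-# OPTIONS --safe #-}
-- Put y a = x i - x a and let m be the number of a ∈ B with y a ≠ 0.  The j-th
-- elementary symmetric polynomial of the y a, a ∈ B, has P(i, B^≠) as its only
-- nonzero term when j = m.  The j-th elementary symmetric polynomial of the
-- squares (y a)² is positive for j ≤ m and zero for j > m, so m ∈ {0, …, |B|} is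
-- found by binary search; one last test then reads off the sign.
module Submission where

open import Defs
open import Algebra.Bundles using (Semiring)
import Algebra.Definitions.RawSemiring as RawSemiringDefs
import Algebra.Properties.AbelianGroup as AbelianGroupProperties
import Algebra.Properties.CommutativeMonoid.Sum as CommutativeMonoidSum
import Algebra.Properties.CommutativeSemigroup as CommutativeSemigroupProperties
import Algebra.Properties.Ring as RingProperties
import Algebra.Properties.Semiring.Exp as SemiringExp
open import Data.Bool.Base using (true; false; not)
open import Data.Empty using (⊥-elim)
open import Data.Fin.Base using (Fin; zero; suc)
open import Data.Fin.Subset using (Subset; inside; outside; ∣_∣; _∉_; _∩_; _⊆_; ∁)
open import Data.Fin.Subset.Properties
  using (_⊆?_; p⊆q⇒∣p∣≤∣q∣; ∣p∩q∣≤∣p∣; drop-∷-⊆; out⊆; s⊆s)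
open import Data.List.Base as List using (List; []; _∷_; _++_; concat; filter)
open import Data.List.Extrema.Nat using (max≤v⁺)
import Data.List.Properties as List
open import Data.List.Relation.Unary.All as All using (All; []; _∷_)
import Data.List.Relation.Unary.All.Properties as All
open import Data.Nat.Base as ℕ using (ℕ; zero; suc; _+_; _*_; _^_; _∸_; _≤_; _<_; z≤n; s≤s; ⌈_/2⌉)
open import Data.Nat.Induction using (<-rec)
open import Data.Nat.Logarithm using (⌈log₂_⌉; ⌈log₂⌈n/2⌉⌉≡⌈log₂n⌉∸1)
import Data.Nat.Properties as ℕ
open import Data.Product.Base using (_×_; _,_; proj₂)
open import Data.Sum.Base using (inj₁; inj₂)
open import Data.Unit.Base using (tt)
open import Data.Vec.Base as Vec using ([]; _∷_; here; lookup; tabulate; replicate; _[_]≔_)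
import Data.Vec.Properties as Vec
open import Data.Vec.Functional using (Vector)
open import Function.Base using (_∘_; case_of_)
open import Function.Bundles using (_⇔_; mk⇔)
open import Level using (Level)
open import Relation.Binary.Definitions using (tri<; tri≈; tri>)
open import Relation.Binary.PropositionalEquality as ≡ using (_≡_; cong; cong₂; subst)
open import Relation.Binary.Structures using (IsStrictTotalOrder)
import Relation.Binary.Reasoning.Setoid as SetoidReasoning
open import Relation.Nullary using (¬_; yes; no; does; _×-dec_)
open import Relation.Nullary.Decidable using (does-⇔)
open import Relation.Unary using (Pred; Decidable)

private variable
  a b p q : Level
  n : ℕ

-- The binary logarithm.

n≤2^⌈log₂n⌉ : ∀ n → n ≤ 2 ^ ⌈log₂ n ⌉
n≤2^⌈log₂n⌉ = <-rec _ step
  where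
  step : ∀ n → (∀ {m} → m < n → m ≤ 2 ^ ⌈log₂ m ⌉) → n ≤ 2 ^ ⌈log₂ n ⌉
  step 0 _ = z≤n
  step 1 _ = ℕ.≤-refl
  step n@(suc (suc k)) rec = begin
    n                              ≡⟨ ℕ.⌊n/2⌋+⌈n/2⌉≡n n ⟨
    ℕ.⌊ n /2⌋ + h                  ≤⟨ ℕ.+-monoˡ-≤ h (ℕ.⌊n/2⌋≤⌈n/2⌉ n) ⟩
    h + h                          ≡⟨ cong (h +_) (ℕ.+-identityʳ h) ⟨
    2 * h                          ≤⟨ ℕ.*-monoʳ-≤ 2 (rec (ℕ.⌈n/2⌉<n k)) ⟩
    -- As `n` is at least 2, `⌈log₂ n ⌉` computes to a successor, so `2 * 2 ^ (⌈log₂ n ⌉ ∸ 1)` is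
    -- the right-hand side by definition.
    2 * 2 ^ ⌈log₂ h ⌉              ≡⟨ cong (λ e → 2 * 2 ^ e) (⌈log₂⌈n/2⌉⌉≡⌈log₂n⌉∸1 n) ⟩
    2 ^ ⌈log₂ n ⌉                  ∎
    where
    h = ⌈ n /2⌉
    open ℕ.≤-Reasoning

-- Subsets of a given set with prescribed size.

filter-map : {A : Set a} {B : Set b} {P : Pred A p} {Q : Pred B q}
             (P? : Decidable P) (Q? : Decidable Q) (f : A → B) →
             (∀ x → Q (f x) ⇔ P x) → ∀ xs →
             filter Q? (List.map f xs) ≡ List.map f (filter P? xs)
filter-map P? Q? f Q∘f⇔P [] = ≡.refl
filter-map P? Q? f Q∘f⇔P (x ∷ xs)
  -- Equivalent predicates have decisions with the same Boolean, so one case split drives both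
  -- filters.
  rewrite does-⇔ (Q∘f⇔P x) (Q? (f x)) (P? x) with does (P? x)
... | true  = cong (f x ∷_) (filter-map P? Q? f Q∘f⇔P xs)
... | false = filter-map P? Q? f Q∘f⇔P xs

OfSize : Subset n → ℕ → Pred (Subset n) _
OfSize B j D = D ⊆ B × ∣ D ∣ ≡ j

ofSize? : (B : Subset n) (j : ℕ) → Decidable (OfSize B j)
ofSize? B j D = (D ⊆? B) ×-dec (∣ D ∣ ℕ.≟ j)

subsetsOfSize : Subset n → ℕ → List (Subset n)
subsetsOfSize {n} B j = filter (ofSize? B j) (subsets n)

subsetsOfSize-∣∣≤ : (B : Subset n) (j : ℕ) → All (λ D → ∣ D ∣ ≤ ∣ B ∣) (subsetsOfSize B j)
subsetsOfSize-∣∣≤ {n} B j =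
  All.map (λ (D⊆B , _) → p⊆q⇒∣p∣≤∣q∣ D⊆B) (All.all-filter (ofSize? B j) (subsets n))

module _ (B : Subset n) where

  private
    filter-∷ : ∀ {s j} → filter (ofSize? (s ∷ B) j) (subsets (suc n)) ≡
               filter (ofSize? (s ∷ B) j) (List.map (outside ∷_) (subsets n)) ++
               filter (ofSize? (s ∷ B) j) (List.map (inside ∷_) (subsets n))
    filter-∷ {s} {j} = List.filter-++ (ofSize? (s ∷ B) j) (List.map (outside ∷_) (subsets n)) _

    filter-outside : ∀ {s j} → filter (ofSize? (s ∷ B) j) (List.map (outside ∷_) (subsets n)) ≡
                     List.map (outside ∷_) (subsetsOfSize B j)
    filter-outside {s} {j} = filter-map (ofSize? B j) (ofSize? (s ∷ B) j) (outside ∷_)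
      (λ D → mk⇔ (λ (D⊆B , eq) → drop-∷-⊆ D⊆B , eq) (λ (D⊆B , eq) → out⊆ D⊆B , eq)) (subsets n)

    filter-inside-none : ∀ {s j} → (∀ D → ¬ OfSize (s ∷ B) j (inside ∷ D)) →
                         filter (ofSize? (s ∷ B) j) (List.map (inside ∷_) (subsets n)) ≡ []
    filter-inside-none none =
      List.filter-none _ (All.map⁺ (All.universal none (subsets n)))

  subsetsOfSize-outside : ∀ j →
    subsetsOfSize (outside ∷ B) j ≡ List.map (outside ∷_) (subsetsOfSize B j)
  subsetsOfSize-outside j = ≡.trans filter-∷ (≡.trans
    (cong₂ _++_ filter-outside (filter-inside-none λ D (D⊆B , _) → case D⊆B here of λ ()))
    (List.++-identityʳ _))

  subsetsOfSize-inside-zero :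
    subsetsOfSize (inside ∷ B) 0 ≡ List.map (outside ∷_) (subsetsOfSize B 0)
  subsetsOfSize-inside-zero = ≡.trans filter-∷ (≡.trans
    (cong₂ _++_ filter-outside (filter-inside-none λ D → λ { (_ , ()) }))
    (List.++-identityʳ _))

  -- A subset either omits the head, or consists of the head and a subset of the tail with one
  -- element fewer. This is the combinatorial source of the recurrence `esym-inside-suc`.
  subsetsOfSize-inside-suc : ∀ j → subsetsOfSize (inside ∷ B) (suc j) ≡
    List.map (outside ∷_) (subsetsOfSize B (suc j)) ++ List.map (inside ∷_) (subsetsOfSize B j)
  subsetsOfSize-inside-suc j = ≡.trans filter-∷ (cong₂ _++_ filter-outside
    (filter-map (ofSize? B j) (ofSize? (inside ∷ B) (suc j)) (inside ∷_)
      (λ D → mk⇔ (λ (D⊆B , eq) → drop-∷-⊆ D⊆B , ℕ.suc-injective eq)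
                 (λ (D⊆B , eq) → s⊆s D⊆B , cong suc eq)) (subsets n)))

-- Turns the size `∣ B ∣ ∸ μ B` in the definition of `Π` into the cardinality of `unequal x i B`.
∣p∣∸∣p∩q∣ : (p q : Subset n) → ∣ p ∣ ∸ ∣ p ∩ q ∣ ≡ ∣ p ∩ ∁ q ∣
∣p∣∸∣p∩q∣ []            []            = ≡.refl
∣p∣∸∣p∩q∣ (outside ∷ p) (_       ∷ q) = ∣p∣∸∣p∩q∣ p q
∣p∣∸∣p∩q∣ (inside  ∷ p) (inside  ∷ q) = ∣p∣∸∣p∩q∣ p q
∣p∣∸∣p∩q∣ (inside  ∷ p) (outside ∷ q) =
  -- Truncated subtraction commutes with `suc` here because `∣ p ∩ q ∣` is at most `∣ p ∣`.
  ≡.trans (ℕ.+-∸-assoc 1 (∣p∩q∣≤∣p∣ p q)) (cong suc (∣p∣∸∣p∩q∣ p q))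

module _ {c ℓ₁ ℓ₂} (ℝ : CompleteOrderedField c ℓ₁ ℓ₂) where
  open CompleteOrderedField ℝ hiding (zero)
    renaming (_+_ to _⊕_; _*_ to _⊗_; _≤_ to _≤ʳ_; _<_ to _<ʳ_)
  open IsStrictTotalOrder isStrictTotalOrder
    using (irrefl; <-respˡ-≈; <-respʳ-≈) renaming (trans to <-trans)
  open PolynomialTests ℝ
  open RawSemiringDefs (Semiring.rawSemiring semiring) using (product) renaming (_^_ to _^ʳ_)
  open AbelianGroupProperties +-abelianGroup using (⁻¹-involutive)
  open CommutativeMonoidSum *-commutativeMonoid using ()
    renaming (∑-distrib-+ to ∏-distrib-*; sum-cong-≋ to product-cong;
              sum-replicate-zero to product-replicate-1)
  open CommutativeSemigroupProperties *-commutativeSemigroup using ()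
    renaming (interchange to *-interchange)
  open RingProperties ring using (-1*x≈-x; -‿distribˡ-*; -‿distribʳ-*)
  open SemiringExp semiring using (^-homo-*; ^-congʳ)
  open SetoidReasoning setoid

  -- Ordered field arithmetic and signs.

  x<x+y : ∀ {x y} → 0# <ʳ y → x <ʳ x ⊕ y
  x<x+y {x} 0<y = <-respˡ-≈ (+-identityʳ x) (+-monoʳ-< x 0<y)

  +-pos : ∀ {x y} → 0# <ʳ x → 0# <ʳ y → 0# <ʳ x ⊕ y
  +-pos 0<x 0<y = <-trans 0<x (x<x+y 0<y)

  neg⇒0<- : ∀ {x} → x <ʳ 0# → 0# <ʳ - x
  neg⇒0<- {x} x<0 =
    <-respˡ-≈ (-‿inverseˡ x) (<-respʳ-≈ (+-identityʳ (- x)) (+-monoʳ-< (- x) x<0))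

  square-pos : ∀ {x} → ¬ x ≈ 0# → 0# <ʳ x ⊗ x
  square-pos {x} x≉0 with compare x 0#
  ... | tri< x<0 _ _ = <-respʳ-≈ -x*-x≈x*x (*-pos (neg⇒0<- x<0) (neg⇒0<- x<0))
    where
    -x*-x≈x*x : - x ⊗ - x ≈ x ⊗ x
    -x*-x≈x*x = begin
      - x ⊗ - x     ≈⟨ -‿distribˡ-* x (- x) ⟨
      - (x ⊗ - x)   ≈⟨ -‿cong (-‿distribʳ-* x x) ⟨
      - - (x ⊗ x)   ≈⟨ ⁻¹-involutive (x ⊗ x) ⟩
      x ⊗ x         ∎
  ... | tri≈ _ x≈0 _ = ⊥-elim (x≉0 x≈0)
  ... | tri> _ _ 0<x = *-pos 0<x 0<x

  x-y≈0⇒x≈y : ∀ {x y} → x - y ≈ 0# → x ≈ y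
  x-y≈0⇒x≈y {x} {y} x-y≈0 = begin
    x               ≈⟨ +-identityʳ x ⟨
    x ⊕ 0#          ≈⟨ +-congˡ (-‿inverseˡ y) ⟨
    x ⊕ (- y ⊕ y)   ≈⟨ +-assoc x (- y) y ⟨
    (x - y) ⊕ y     ≈⟨ +-congʳ x-y≈0 ⟩
    0# ⊕ y          ≈⟨ +-identityˡ y ⟩
    y               ∎

  x≈y⇒x-y≈0 : ∀ {x y} → x ≈ y → x - y ≈ 0#
  x≈y⇒x-y≈0 {x} {y} x≈y = trans (+-congʳ x≈y) (-‿inverseʳ y)

  sign-neg : ∀ {x} → x <ʳ 0# → sign x ≡ neg
  sign-neg {x} x<0 with compare x 0#
  ... | tri< _ _ _     = ≡.refl
  ... | tri≈ x≮0 _ _   = ⊥-elim (x≮0 x<0)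
  ... | tri> x≮0 _ _   = ⊥-elim (x≮0 x<0)

  sign-nil : ∀ {x} → x ≈ 0# → sign x ≡ nil
  sign-nil {x} x≈0 with compare x 0#
  ... | tri< _ x≉0 _   = ⊥-elim (x≉0 x≈0)
  ... | tri≈ _ _ _     = ≡.refl
  ... | tri> _ x≉0 _   = ⊥-elim (x≉0 x≈0)

  sign-pos : ∀ {x} → 0# <ʳ x → sign x ≡ pos
  sign-pos {x} 0<x with compare x 0#
  ... | tri< _ _ x≯0   = ⊥-elim (x≯0 0<x)
  ... | tri≈ _ _ x≯0   = ⊥-elim (x≯0 0<x)
  ... | tri> _ _ _     = ≡.refl

  -- Equality of reals is the setoid relation `_≈_`, which `sign` does not respect by computation;
  -- each outcome of `compare` has to be transported along it.
  sign-cong : ∀ {x y} → x ≈ y → sign x ≡ sign y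
  sign-cong {x} x≈y with compare x 0#
  ... | tri< x<0 _ _ = ≡.sym (sign-neg (<-respˡ-≈ x≈y x<0))
  ... | tri≈ _ x≈0 _ = ≡.sym (sign-nil (trans (sym x≈y) x≈0))
  ... | tri> _ _ 0<x = ≡.sym (sign-pos (<-respʳ-≈ x≈y 0<x))

  -- Finite sums and elementary symmetric polynomials.

  listSum-++ : ∀ xs ys → listSum (xs ++ ys) ≈ listSum xs ⊕ listSum ys
  listSum-++ []       ys = sym (+-identityˡ _)
  listSum-++ (x ∷ xs) ys = trans (+-congˡ (listSum-++ xs ys)) (sym (+-assoc x _ _))

  listSum-map-cong : {A : Set a} {f g : A → Carrier} → (∀ x → f x ≈ g x) → ∀ xs →
                     listSum (List.map f xs) ≈ listSum (List.map g xs)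
  listSum-map-cong f≈g []       = refl
  listSum-map-cong f≈g (x ∷ xs) = +-cong (f≈g x) (listSum-map-cong f≈g xs)

  listSum-map-* : {A : Set a} (r : Carrier) (f : A → Carrier) → ∀ xs →
                  listSum (List.map (λ x → r ⊗ f x) xs) ≈ r ⊗ listSum (List.map f xs)
  listSum-map-* r f []       = sym (zeroʳ r)
  listSum-map-* r f (x ∷ xs) = trans (+-congˡ (listSum-map-* r f xs)) (sym (distribˡ r _ _))

  -- The elementary symmetric polynomial of index `j` in the values `y a` with `a` in `B`.
  esym : Subset n → ℕ → Vector Carrier n → Carrier
  esym B j y = listSum (List.map (λ D → ∏∈ D y) (subsetsOfSize B j))

  module _ (B : Subset n) (y : Vector Carrier (suc n)) where

    private
      sum-outside : ∀ Ds → listSum (List.map (λ D → ∏∈ D y) (List.map (outside ∷_) Ds)) ≈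
                           listSum (List.map (λ D → ∏∈ D (y ∘ suc)) Ds)
      sum-outside Ds = trans (reflexive (cong listSum (≡.sym (List.map-∘ Ds))))
        (listSum-map-cong (λ D → *-identityˡ _) Ds)

      sum-inside : ∀ Ds → listSum (List.map (λ D → ∏∈ D y) (List.map (inside ∷_) Ds)) ≈
                          y zero ⊗ listSum (List.map (λ D → ∏∈ D (y ∘ suc)) Ds)
      sum-inside Ds = trans (reflexive (cong listSum (≡.sym (List.map-∘ Ds))))
        (listSum-map-* (y zero) _ Ds)

    esym-outside : ∀ j → esym (outside ∷ B) j y ≈ esym B j (y ∘ suc)
    esym-outside j rewrite subsetsOfSize-outside B j = sum-outside (subsetsOfSize B j)

    esym-inside-zero : esym (inside ∷ B) 0 y ≈ esym B 0 (y ∘ suc)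
    esym-inside-zero rewrite subsetsOfSize-inside-zero B = sum-outside (subsetsOfSize B 0)

    -- Separates the subsets that omit the head from those that contain it, the latter contributing
    -- the factor `y zero`. The inductions on `B` below rest on this recurrence.
    esym-inside-suc : ∀ j → esym (inside ∷ B) (suc j) y ≈
                      esym B (suc j) (y ∘ suc) ⊕ y zero ⊗ esym B j (y ∘ suc)
    esym-inside-suc j
      rewrite subsetsOfSize-inside-suc B j
            | List.map-++ (λ D → ∏∈ D y) (List.map (outside ∷_) (subsetsOfSize B (suc j)))
                (List.map (inside ∷_) (subsetsOfSize B j)) =
      trans (listSum-++ (List.map (λ D → ∏∈ D y) (List.map (outside ∷_) (subsetsOfSize B (suc j)))) _)
        (+-cong (sum-outside (subsetsOfSize B (suc j))) (sum-inside (subsetsOfSize B j)))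

    esym-inside-null : y zero ≈ 0# → ∀ j → esym (inside ∷ B) j y ≈ esym B j (y ∘ suc)
    esym-inside-null y₀≈0 zero    = esym-inside-zero
    esym-inside-null y₀≈0 (suc j) = begin
      esym (inside ∷ B) (suc j) y                       ≈⟨ esym-inside-suc j ⟩
      esym B (suc j) (y ∘ suc) ⊕ y zero ⊗ esym B j (y ∘ suc)  ≈⟨ +-congˡ (trans (*-congʳ y₀≈0) (zeroˡ _)) ⟩
      esym B (suc j) (y ∘ suc) ⊕ 0#                     ≈⟨ +-identityʳ _ ⟩
      esym B (suc j) (y ∘ suc)                          ∎

  -- Built from the Boolean of `y a ≟ 0#`, so that a case split on `y zero ≟ 0#` makes the head of
  -- `B ∩ support y` compute.
  support : Vector Carrier n → Subset n
  support y = tabulate λ a → not (does (y a ≟ 0#))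

  support-cong : {y z : Vector Carrier n} → (∀ a → y a ≈ 0# ⇔ z a ≈ 0#) → support y ≡ support z
  support-cong {y = y} {z} y⇔z = Vec.tabulate-cong λ a →
    cong not (does-⇔ (y⇔z a) (y a ≟ 0#) (z a ≟ 0#))

  -- A subset of `B` with more elements than `B ∩ support y` contains an index where `y` is zero, so
  -- every term has a zero factor.
  esym-vanishes : ∀ (B : Subset n) y {j} → ∣ B ∩ support y ∣ < j → esym B j y ≈ 0#
  esym-vanishes []            y {suc j} _  = refl
  esym-vanishes (outside ∷ B) y {j} m<j = trans (esym-outside B y j) (esym-vanishes B (y ∘ suc) m<j)
  esym-vanishes (inside ∷ B)  y {j} m<j with y zero ≟ 0#
  ... | yes y₀≈0 = trans (esym-inside-null B y y₀≈0 j) (esym-vanishes B (y ∘ suc) m<j)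
  esym-vanishes (inside ∷ B)  y {suc j} (s≤s m<j) | no _ = begin
    esym (inside ∷ B) (suc j) y                             ≈⟨ esym-inside-suc B y j ⟩
    esym B (suc j) (y ∘ suc) ⊕ y zero ⊗ esym B j (y ∘ suc)  ≈⟨ +-cong (esym-vanishes B (y ∘ suc) (ℕ.m<n⇒m<1+n m<j))
                                                                (*-congˡ (esym-vanishes B (y ∘ suc) m<j)) ⟩
    0# ⊕ y zero ⊗ 0#                                        ≈⟨ trans (+-identityˡ _) (zeroʳ _) ⟩
    0#                                                      ∎

  -- Among the subsets of `B` of this size, only `B ∩ support y` itself avoids all zeros of `y`;
  -- every other term vanishes.
  esym-top : ∀ (B : Subset n) y → esym B ∣ B ∩ support y ∣ y ≈ ∏∈ (B ∩ support y) y
  esym-top []            y = +-identityʳ 1#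
  esym-top (outside ∷ B) y =
    trans (esym-outside B y _) (trans (esym-top B (y ∘ suc)) (sym (*-identityˡ _)))
  esym-top (inside ∷ B)  y with y zero ≟ 0#
  ... | yes y₀≈0 =
    trans (esym-inside-null B y y₀≈0 _) (trans (esym-top B (y ∘ suc)) (sym (*-identityˡ _)))
  ... | no _ = begin
    esym (inside ∷ B) (suc m) y                             ≈⟨ esym-inside-suc B y m ⟩
    -- The first summand has index `suc m`, but the tail has only `m` nonzero values.
    esym B (suc m) (y ∘ suc) ⊕ y zero ⊗ esym B m (y ∘ suc)  ≈⟨ +-cong (esym-vanishes B (y ∘ suc) ℕ.≤-refl)
                                                                (*-congˡ (esym-top B (y ∘ suc))) ⟩
    0# ⊕ y zero ⊗ ∏∈ (B ∩ support (y ∘ suc)) (y ∘ suc)      ≈⟨ +-identityˡ _ ⟩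
    y zero ⊗ ∏∈ (B ∩ support (y ∘ suc)) (y ∘ suc)           ∎
    where m = ∣ B ∩ support (y ∘ suc) ∣

  -- The hypothesis makes all values nonnegative, so no terms cancel, and `j` indices can be chosen
  -- inside the support to give a positive term.
  esym-positive : ∀ (B : Subset n) y → (∀ a → ¬ y a ≈ 0# → 0# <ʳ y a) →
                  ∀ {j} → j ≤ ∣ B ∩ support y ∣ → 0# <ʳ esym B j y
  esym-positive []            y y≥0 z≤n = <-respʳ-≈ (sym (+-identityʳ 1#)) 0<1
  esym-positive (outside ∷ B) y y≥0 {j} j≤m =
    <-respʳ-≈ (sym (esym-outside B y j)) (esym-positive B (y ∘ suc) (y≥0 ∘ suc) j≤m)
  esym-positive (inside ∷ B)  y y≥0 {j} j≤m with y zero ≟ 0#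
  ... | yes y₀≈0 =
    <-respʳ-≈ (sym (esym-inside-null B y y₀≈0 j)) (esym-positive B (y ∘ suc) (y≥0 ∘ suc) j≤m)
  esym-positive (inside ∷ B)  y y≥0 {zero}  _ | no _ =
    <-respʳ-≈ (sym (esym-inside-zero B y)) (esym-positive B (y ∘ suc) (y≥0 ∘ suc) z≤n)
  esym-positive (inside ∷ B)  y y≥0 {suc j} (s≤s j≤m) | no y₀≉0 =
    <-respʳ-≈ (sym (esym-inside-suc B y j)) positive
    where
    rest = *-pos (y≥0 zero y₀≉0) (esym-positive B (y ∘ suc) (y≥0 ∘ suc) j≤m)

    positive : 0# <ʳ esym B (suc j) (y ∘ suc) ⊕ y zero ⊗ esym B j (y ∘ suc)
    -- The summand omitting the head is positive if the tail has at least `suc j` nonzero values,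
    -- and zero otherwise. The summand `rest` is positive in both cases.
    positive with ℕ.≤-<-connex (suc j) ∣ B ∩ support (y ∘ suc) ∣
    ... | inj₁ j<m = +-pos (esym-positive B (y ∘ suc) (y≥0 ∘ suc) j<m) rest
    ... | inj₂ m≤j = <-respʳ-≈
      (trans (sym (+-identityˡ _)) (+-congʳ (sym (esym-vanishes B (y ∘ suc) m≤j)))) rest

  -- The sign of `Π`.

  module _ (x : Vector Carrier n) (i : Fin n) where

    ∁ties≡support : ∁ (ties x i) ≡ support (λ a → x i - x a)
    ∁ties≡support = ≡.trans (≡.sym (Vec.tabulate-∘ not _)) (Vec.tabulate-cong λ a →
      cong not (does-⇔ (mk⇔ (x≈y⇒x-y≈0 ∘ sym) (sym ∘ x-y≈0⇒x≈y)) (x a ≟ x i) (x i - x a ≟ 0#)))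

    unequal≡support : ∀ B → unequal x i B ≡ B ∩ support (λ a → x i - x a)
    unequal≡support B = cong (B ∩_) ∁ties≡support

    -- `Π` unfolds to `esym` at the index `∣ B ∣ ∸ μ B`, so only this index has to be rewritten.
    Π≡esym : ∀ B → Π x i B ≡ esym B ∣ unequal x i B ∣ (λ a → x i - x a)
    Π≡esym B = cong (λ j → esym B j (λ a → x i - x a)) (∣p∣∸∣p∩q∣ B (ties x i))

    -- The two reals are in fact equal: by `esym-top`, `Π` reduces to the product over
    -- `unequal x i B`.
    sign-Π : ∀ B → sign (Π x i B) ≡ sign (P x i (unequal x i B))
    sign-Π B rewrite Π≡esym B | unequal≡support B = sign-cong (esym-top B (λ a → x i - x a))

  -- Formal polynomials and their evaluation.

  monomial : Vector Carrier n → Exponent n → Carrier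
  monomial x α = product λ j → x j ^ʳ lookup α j

  monomial-zero : (x : Vector Carrier n) → monomial x (replicate n 0) ≈ 1#
  monomial-zero {n} x =
    trans (product-cong (λ j → ^-congʳ (x j) (Vec.lookup-replicate j 0))) (product-replicate-1 n)

  monomial-unit : (x : Vector Carrier n) (j : Fin n) → monomial x (replicate n 0 [ j ]≔ 1) ≈ x j
  monomial-unit x zero    = trans (*-cong (*-identityʳ _) (monomial-zero (x ∘ suc))) (*-identityʳ _)
  monomial-unit x (suc j) = trans (*-identityˡ _) (monomial-unit (x ∘ suc) j)

  monomial-+ : (x : Vector Carrier n) (α β : Exponent n) →
               monomial x (Vec.zipWith _+_ α β) ≈ monomial x α ⊗ monomial x β
  monomial-+ x α β = trans
    (product-cong λ j → trans (^-congʳ (x j) (Vec.lookup-zipWith _+_ j α β))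
                               (^-homo-* (x j) (lookup α j) (lookup β j)))
    (∏-distrib-* (λ j → x j ^ʳ lookup α j) _)

  1ᵖ : Polynomial n
  1ᵖ {n} = (1# , replicate n 0) ∷ []

  Δᵖ : Fin n → Fin n → Polynomial n
  Δᵖ {n} i a = (1# , replicate n 0 [ i ]≔ 1) ∷ (- 1# , replicate n 0 [ a ]≔ 1) ∷ []

  _*ᵗ_ : Carrier × Exponent n → Carrier × Exponent n → Carrier × Exponent n
  (r , α) *ᵗ (s , β) = r ⊗ s , Vec.zipWith _+_ α β

  _*ᵖ_ : Polynomial n → Polynomial n → Polynomial n
  []      *ᵖ q = []
  (t ∷ p) *ᵖ q = List.map (t *ᵗ_) q ++ p *ᵖ q

  ∏ᵖ : ∀ {m} → Subset m → (Fin m → Polynomial n) → Polynomial n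
  ∏ᵖ []            f = 1ᵖ
  ∏ᵖ (outside ∷ D) f = ∏ᵖ D (f ∘ suc)
  ∏ᵖ (inside  ∷ D) f = f zero *ᵖ ∏ᵖ D (f ∘ suc)

  -- The formal counterpart of `esym`. The variables are replaced by arbitrary polynomials `f a`,
  -- which covers both the differences and their squares.
  esymᵖ : ∀ {m} → Subset m → ℕ → (Fin m → Polynomial n) → Polynomial n
  esymᵖ B j f = concat (List.map (λ D → ∏ᵖ D f) (subsetsOfSize B j))

  module _ (x : Vector Carrier n) where

    eval-++ : ∀ p q → eval (p ++ q) x ≈ eval p x ⊕ eval q x
    eval-++ p q = trans (reflexive (cong listSum (List.map-++ _ p q)))
      (listSum-++ (List.map (λ (r , α) → r ⊗ monomial x α) p) _)

    eval-concat : ∀ ps → eval (concat ps) x ≈ listSum (List.map (λ p → eval p x) ps)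
    eval-concat []       = refl
    eval-concat (p ∷ ps) = trans (eval-++ p (concat ps)) (+-congˡ (eval-concat ps))

    eval-1ᵖ : eval 1ᵖ x ≈ 1#
    eval-1ᵖ = trans (+-identityʳ _) (trans (*-identityˡ _) (monomial-zero x))

    eval-Δᵖ : ∀ i a → eval (Δᵖ i a) x ≈ x i - x a
    eval-Δᵖ i a = +-cong (trans (*-identityˡ _) (monomial-unit x i))
      (trans (+-identityʳ _) (trans (-1*x≈-x _) (-‿cong (monomial-unit x a))))

    eval-*ᵗ : ∀ r α q → eval (List.map ((r , α) *ᵗ_) q) x ≈ (r ⊗ monomial x α) ⊗ eval q x
    eval-*ᵗ r α []            = sym (zeroʳ _)
    eval-*ᵗ r α ((s , β) ∷ q) = trans
      (+-cong (trans (*-congˡ (monomial-+ x α β)) (*-interchange r s _ _)) (eval-*ᵗ r α q))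
      (sym (distribˡ _ _ _))

    eval-*ᵖ : ∀ p q → eval (p *ᵖ q) x ≈ eval p x ⊗ eval q x
    eval-*ᵖ []            q = sym (zeroˡ _)
    eval-*ᵖ ((r , α) ∷ p) q = trans (eval-++ (List.map ((r , α) *ᵗ_) q) (p *ᵖ q))
      (trans (+-cong (eval-*ᵗ r α q) (eval-*ᵖ p q)) (sym (distribʳ _ _ _)))

    eval-∏ᵖ : ∀ {m} (D : Subset m) {f y} → (∀ a → eval (f a) x ≈ y a) → eval (∏ᵖ D f) x ≈ ∏∈ D y
    eval-∏ᵖ []                f≈y = eval-1ᵖ
    eval-∏ᵖ (outside ∷ D)     f≈y = trans (eval-∏ᵖ D (f≈y ∘ suc)) (sym (*-identityˡ _))
    eval-∏ᵖ (inside  ∷ D) {f} f≈y =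
      trans (eval-*ᵖ (f zero) (∏ᵖ D (f ∘ suc))) (*-cong (f≈y zero) (eval-∏ᵖ D (f≈y ∘ suc)))

    eval-esymᵖ : ∀ {m} (B : Subset m) j {f y} → (∀ a → eval (f a) x ≈ y a) →
                 eval (esymᵖ B j f) x ≈ esym B j y
    eval-esymᵖ B j {f} f≈y = begin
      eval (esymᵖ B j f) x
        ≈⟨ eval-concat (List.map (λ D → ∏ᵖ D f) (subsetsOfSize B j)) ⟩
      listSum (List.map (λ p → eval p x) (List.map (λ D → ∏ᵖ D f) (subsetsOfSize B j)))
        ≡⟨ cong listSum (List.map-∘ (subsetsOfSize B j)) ⟨
      listSum (List.map (λ D → eval (∏ᵖ D f) x) (subsetsOfSize B j))
        ≈⟨ listSum-map-cong (λ D → eval-∏ᵖ D f≈y) (subsetsOfSize B j) ⟩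
      esym B j _ ∎

  -- Degree bounds.

  TermDegrees≤ : ℕ → Polynomial n → Set c
  TermDegrees≤ d = All λ t → Vec.sum (proj₂ t) ≤ d

  -- `degree` takes a maximum over some of the listed exponents, those with nonzero collected
  -- coefficient, so cancellation can only lower it.
  degree≤ : ∀ {d} {p : Polynomial n} → TermDegrees≤ d p → degree p ≤ d
  degree≤ p≤d = max≤v⁺ z≤n (All.map⁺ (All.filter⁺ _ (All.map⁺ p≤d)))

  sum-replicate-0 : ∀ n → Vec.sum (replicate n 0) ≡ 0
  sum-replicate-0 zero    = ≡.refl
  sum-replicate-0 (suc n) = sum-replicate-0 n

  sum-unit : (j : Fin n) → Vec.sum (replicate n 0 [ j ]≔ 1) ≡ 1
  sum-unit {suc n} zero    = cong suc (sum-replicate-0 n)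
  sum-unit         (suc j) = sum-unit j

  sum-zipWith-+ : (α β : Exponent n) → Vec.sum (Vec.zipWith _+_ α β) ≡ Vec.sum α + Vec.sum β
  sum-zipWith-+ []      []      = ≡.refl
  sum-zipWith-+ (k ∷ α) (l ∷ β) =
    ≡.trans (cong (k + l +_) (sum-zipWith-+ α β)) (ℕ+.interchange k l _ _)
    where module ℕ+ = CommutativeSemigroupProperties ℕ.+-commutativeSemigroup

  Δᵖ-degrees : (i a : Fin n) → TermDegrees≤ 1 (Δᵖ i a)
  Δᵖ-degrees i a = ℕ.≤-reflexive (sum-unit i) ∷ ℕ.≤-reflexive (sum-unit a) ∷ []

  *ᵖ-degrees : ∀ {d e} {p q : Polynomial n} →
               TermDegrees≤ d p → TermDegrees≤ e q → TermDegrees≤ (d + e) (p *ᵖ q)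
  *ᵖ-degrees {p = []}          []          q≤e = []
  *ᵖ-degrees {p = (_ , α) ∷ _} (α≤d ∷ p≤d) q≤e = All.++⁺
    (All.map⁺ (All.map (λ {t} β≤e →
      ℕ.≤-trans (ℕ.≤-reflexive (sum-zipWith-+ α (proj₂ t))) (ℕ.+-mono-≤ α≤d β≤e)) q≤e))
    (*ᵖ-degrees p≤d q≤e)

  ∏ᵖ-degrees : ∀ {m d} (D : Subset m) {f : Fin m → Polynomial n} →
               (∀ a → TermDegrees≤ d (f a)) → TermDegrees≤ (∣ D ∣ * d) (∏ᵖ D f)
  ∏ᵖ-degrees {n} []        f≤d = ℕ.≤-reflexive (sum-replicate-0 n) ∷ []
  ∏ᵖ-degrees (outside ∷ D) f≤d = ∏ᵖ-degrees D (f≤d ∘ suc)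
  ∏ᵖ-degrees (inside  ∷ D) f≤d = *ᵖ-degrees (f≤d zero) (∏ᵖ-degrees D (f≤d ∘ suc))

  -- Each term comes from a subset of `B`, which has at most `∣ B ∣` factors. The bound is uniform
  -- in `j`, as the search may also test indices above `∣ B ∣`.
  esymᵖ-degrees : ∀ {m d} (B : Subset m) j {f : Fin m → Polynomial n} →
                  (∀ a → TermDegrees≤ d (f a)) → TermDegrees≤ (∣ B ∣ * d) (esymᵖ B j f)
  esymᵖ-degrees {d = d} B j f≤d = All.concat⁺ (All.map⁺ (All.map
    (λ {D} D≤B → All.map (λ ≤d → ℕ.≤-trans ≤d (ℕ.*-monoˡ-≤ d D≤B)) (∏ᵖ-degrees D f≤d))
    (subsetsOfSize-∣∣≤ B j)))

  -- Binary search by sign tests.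

  branch : {A : Set a} → A → A → Sign → A
  branch lower upper pos = upper
  branch lower upper _   = lower

  -- Looks for m in [lo , lo + 2 ^ k), where p j is positive exactly for j ≤ m.
  search : {A : Set} → (ℕ → Polynomial n) → (ℕ → DecisionTree n A) → ℕ → ℕ → DecisionTree n A
  search p T zero    lo = T lo
  search p T (suc k) lo =
    test (p (2 ^ k + lo)) (branch (search p T k lo) (search p T k (2 ^ k + lo)))

  module _ {A : Set} {p : ℕ → Polynomial n} {T : ℕ → DecisionTree n A} where

    depth-search : ∀ {d} → (∀ j → depth (T j) ≤ d) → ∀ k lo → depth (search p T k lo) ≤ k + d
    depth-search T≤d zero    lo = T≤d lo
    depth-search T≤d (suc k) lo = s≤s (ℕ.⊔-lub
      (ℕ.⊔-lub (depth-search T≤d k lo) (depth-search T≤d k lo))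
      (depth-search T≤d k (2 ^ k + lo)))

    testDegrees-search : ∀ {d} → (∀ j → degree (p j) ≤ d) → (∀ j → TestDegrees≤ d (T j)) →
                         ∀ k lo → TestDegrees≤ d (search p T k lo)
    testDegrees-search p≤d T≤d zero    lo = T≤d lo
    testDegrees-search p≤d T≤d (suc k) lo = p≤d (2 ^ k + lo) , λ where
      neg → testDegrees-search p≤d T≤d k lo
      nil → testDegrees-search p≤d T≤d k lo
      pos → testDegrees-search p≤d T≤d k (2 ^ k + lo)

    -- The invariant is that `m` lies in the current interval. A positive answer at the midpoint
    -- `2 ^ k + lo` keeps the upper half, a zero answer the lower half.
    run-search : ∀ {x m} → (∀ {j} → j ≤ m → sign (eval (p j) x) ≡ pos) →
                 (∀ {j} → m < j → sign (eval (p j) x) ≡ nil) →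
                 ∀ k {lo} → lo ≤ m → m < 2 ^ k + lo → run (search p T k lo) x ≡ run (T m) x
    -- Here `2 ^ 0 + lo` computes to `suc lo`, so the interval has `lo` as its only element.
    run-search {x} ≤⇒pos >⇒nil zero lo≤m (s≤s m≤lo) =
      cong (λ j → run (T j) x) (ℕ.≤-antisym lo≤m m≤lo)
    run-search {x} {m} ≤⇒pos >⇒nil (suc k) {lo} lo≤m m<hi with ℕ.≤-<-connex (2 ^ k + lo) m
    ... | inj₁ mid≤m rewrite ≤⇒pos mid≤m = run-search ≤⇒pos >⇒nil k mid≤m (subst (m <_) hi≡ m<hi)
      where
      hi≡ : 2 ^ suc k + lo ≡ 2 ^ k + (2 ^ k + lo)
      hi≡ = ≡.trans (cong (λ e → 2 ^ k + e + lo) (ℕ.+-identityʳ (2 ^ k))) (ℕ.+-assoc (2 ^ k) _ lo)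
    ... | inj₂ m<mid rewrite >⇒nil m<mid = run-search ≤⇒pos >⇒nil k lo≤m m<mid

  -- The decision tree for the sign of `Π`.

  module _ (i : Fin n) (B : Subset n) where

    -- With the differences themselves, terms of opposite sign could cancel below the threshold.
    -- Squaring prevents this and accounts for the factor 2 in the degree bound.
    squareTest : ℕ → Polynomial n
    squareTest j = esymᵖ B j λ a → Δᵖ i a *ᵖ Δᵖ i a

    finalTest : ℕ → DecisionTree n Sign
    finalTest j = test (esymᵖ B j (Δᵖ i)) output

    squareTest-degree : ∀ j → degree (squareTest j) ≤ 2 * ∣ B ∣
    squareTest-degree j = subst (degree (squareTest j) ≤_) (ℕ.*-comm ∣ B ∣ 2)
      (degree≤ (esymᵖ-degrees B j λ a → *ᵖ-degrees (Δᵖ-degrees i a) (Δᵖ-degrees i a)))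

    finalTest-degree : ∀ j → TestDegrees≤ (2 * ∣ B ∣) (finalTest j)
    finalTest-degree j = ℕ.≤-trans (degree≤ (esymᵖ-degrees B j (Δᵖ-degrees i)))
      (ℕ.≤-trans (ℕ.≤-reflexive (ℕ.*-identityʳ ∣ B ∣)) (ℕ.m≤m+n ∣ B ∣ _)) , λ _ → tt

    module _ (x : Vector Carrier n) where

      private
        y y² : Vector Carrier n
        y  a = x i - x a
        y² a = y a ⊗ y a

        m : ℕ
        m = ∣ unequal x i B ∣

        y²-pos : ∀ a → ¬ y² a ≈ 0# → 0# <ʳ y² a
        y²-pos a y²≉0 = square-pos λ y≈0 → y²≉0 (trans (*-congʳ y≈0) (zeroˡ _))

        y²≈0⇔y≈0 : ∀ a → y² a ≈ 0# ⇔ y a ≈ 0#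
        y²≈0⇔y≈0 a = mk⇔ to (λ y≈0 → trans (*-congʳ y≈0) (zeroˡ _))
          where
          to : y² a ≈ 0# → y a ≈ 0#
          to y²≈0 with y a ≟ 0#
          ... | yes y≈0 = y≈0
          ... | no  y≉0 = ⊥-elim (irrefl (sym y²≈0) (square-pos y≉0))

        -- Squaring preserves the support, so the index at which the square tests turn zero counts
        -- the nonzero differences.
        m≡ : m ≡ ∣ B ∩ support y² ∣
        m≡ = cong ∣_∣ (≡.trans (unequal≡support x i B)
          (cong (B ∩_) (≡.sym (support-cong y²≈0⇔y≈0))))

        eval-squareTest : ∀ j → eval (squareTest j) x ≈ esym B j y²
        eval-squareTest j = eval-esymᵖ x B j λ a →
          trans (eval-*ᵖ x (Δᵖ i a) (Δᵖ i a)) (*-cong (eval-Δᵖ x i a) (eval-Δᵖ x i a))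

      squareTest-pos : ∀ {j} → j ≤ m → sign (eval (squareTest j) x) ≡ pos
      squareTest-pos {j} j≤m = ≡.trans (sign-cong (eval-squareTest j))
        (sign-pos (esym-positive B y² y²-pos (subst (j ≤_) m≡ j≤m)))

      squareTest-nil : ∀ {j} → m < j → sign (eval (squareTest j) x) ≡ nil
      squareTest-nil {j} m<j = ≡.trans (sign-cong (eval-squareTest j))
        (sign-nil (esym-vanishes B y² (subst (_< j) m≡ m<j)))

      -- At the index found by the search, the tested polynomial evaluates to `Π x i B`.
      run-finalTest : run (finalTest m) x ≡ sign (Π x i B)
      run-finalTest = sign-cong (trans (eval-esymᵖ x B m (eval-Δᵖ x i)) (reflexive (≡.sym (Π≡esym x i B))))

    -- The number of nonzero differences is one of `∣ B ∣ + 1` candidates, all below `2 ^ k`. The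
    -- search spends `k` tests to find it, and the leaf one more.
    sign-Π-determined :
      DeterminedByTests (⌈log₂ (∣ B ∣ + 1) ⌉ + 1) (2 * ∣ B ∣) (λ x → sign (Π x i B))
    sign-Π-determined = search squareTest finalTest k 0
      , depth-search (λ _ → ℕ.≤-refl) k 0
      , testDegrees-search squareTest-degree finalTest-degree k 0
      , λ x → ≡.trans
          (run-search (squareTest-pos x) (squareTest-nil x) k z≤n (m<2^k x))
          (run-finalTest x)
      where
      k = ⌈log₂ (∣ B ∣ + 1) ⌉

      -- The summand `0` is the initial value of `lo`.
      m<2^k : ∀ x → ∣ unequal x i B ∣ < 2 ^ k + 0
      m<2^k x = ℕ.≤-trans (s≤s (∣p∩q∣≤∣p∣ B (∁ (ties x i))))
        (subst (_≤ 2 ^ k + 0) (ℕ.+-comm ∣ B ∣ 1)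
          (ℕ.≤-trans (n≤2^⌈log₂n⌉ (∣ B ∣ + 1)) (ℕ.≤-reflexive (≡.sym (ℕ.+-identityʳ _)))))

proposition1 : ∀ {c ℓ₁ ℓ₂} (ℝ : CompleteOrderedField c ℓ₁ ℓ₂) →
  let open CompleteOrderedField ℝ using (Carrier)
      open PolynomialTests ℝ
  in ∀ {n : ℕ} (i : Fin n) (B : Subset n) → i ∉ B →
     (∀ (x : Vector Carrier n) → sign (Π x i B) ≡ sign (P x i (unequal x i B)))
     × DeterminedByTests (⌈log₂ (∣ B ∣ + 1) ⌉ + 1) (2 * ∣ B ∣) (λ x → sign (Π x i B))
proposition1 ℝ i B _ = (λ x → sign-Π ℝ x i B) , sign-Π-determined ℝ i B
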